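{- Let $H$ be a connected graph of order $a \in \mathbb{N}$. Then for every $b \in \mathbb{N}$, $R_\mathrm{ord}(H, P_b^\mathrm{mon}) = 1 + (a-1)(b-1)$.
   Context: All graphs are finite, simple and undirected, and a graph of order $n$ has vertex set $\{0,1,\ldots,n-1\}$; $K_n$ is the complete graph on $\{0,\ldots,n-1\}$. A $2$-edge-coloring of $K_n$ assigns each edge a color in $\{1,2\}$. For a graph $H$ and such a coloring, an embedding of $H$ in color $j$ is an injective map $\varphi\colon V(H)\to V(K_n)$ such that for every edge $uv$ of $H$ the edge $\{\varphi(u),\varphi(v)\}$ has color $j$; it is increasing if $\varphi(0)<\varphi(1)<\cdots<\varphi(|H|-1)$. The ordered Ramsey number $R_\mathrm{ord}(H_1,H_2)$ is the smallest $n\in\mathbb{N}$ such that every $2$-edge-coloring of $K_n$ admits an increasing embedding of $H_1$ in color $1$ or an increasing embedding of $H_2$ in color $2$. The monotone path $P_n^\mathrm{mon}$ is the graph of order $n$ in which two vertices are adjacent iff they are consecutive integers. -}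

module Defs where

open import Level using (0ℓ)
open import Data.Nat.Base using (ℕ; suc; _≤_)
open import Data.Nat.Properties using (1+n≢n) renaming (_≟_ to _≟ℕ_)
open import Data.Fin.Base using (Fin; toℕ; _<_)
open import Data.Fin.Properties using (_≟_)
open import Data.Product.Base using (∃; _×_)
open import Data.Sum.Base using (_⊎_; inj₁; inj₂; swap)
open import Function.Base using (_∘_)
open import Function.Definitions using (Injective)
open import Relation.Binary.Core using (Rel; _Preserves_⟶_)
open import Relation.Binary.Definitions using (Decidable; Irreflexive; Symmetric)
open import Relation.Binary.Construct.Closure.ReflexiveTransitive using (Star)
open import Relation.Binary.PropositionalEquality.Core using (_≡_; _≢_; refl; sym)
open import Relation.Nullary.Decidable.Core using (¬?; _⊎-dec_)

-- Adjacency is required to be decidable, as it always is classically.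
record Graph (n : ℕ) : Set₁ where
  field
    Adj        : Rel (Fin n) 0ℓ
    adj?       : Decidable Adj
    adj-sym    : Symmetric Adj
    adj-irrefl : Irreflexive _≡_ Adj

open Graph public

-- Star (Adj H) u v is the type of walks from u to v.  The graph of order 0
-- satisfies this vacuously and has to be excluded separately.
Connected : ∀ {n} → Graph n → Set
Connected H = ∀ u v → Star (Adj H) u v

complete : ∀ n → Graph n
complete n = record
  { Adj        = _≢_
  ; adj?       = λ u v → ¬? (u ≟ v)
  ; adj-sym    = λ u≢v → u≢v ∘ sym
  ; adj-irrefl = λ u≡v u≢v → u≢v u≡v
  }

monotonePath : ∀ n → Graph n
monotonePath n = record
  { Adj        = λ u v → suc (toℕ u) ≡ toℕ v ⊎ suc (toℕ v) ≡ toℕ u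
  ; adj?       = λ u v → (suc (toℕ u) ≟ℕ toℕ v) ⊎-dec (suc (toℕ v) ≟ℕ toℕ u)
  ; adj-sym    = swap
  ; adj-irrefl = λ { refl (inj₁ eq) → 1+n≢n eq ; refl (inj₂ eq) → 1+n≢n eq }
  }

data Color : Set where
  color₁ color₂ : Color

-- The edge proof is irrelevant, and together with color-sym this makes the
-- color a function of the unordered pair {u , v}.
record EdgeColoring {n : ℕ} (G : Graph n) : Set where
  field
    color     : (u v : Fin n) → .(Adj G u v) → Color
    color-sym : ∀ {u v} (e : Adj G u v) → color u v e ≡ color v u (adj-sym G e)

open EdgeColoring public

record Embedding {k n : ℕ} (H : Graph k) (c : EdgeColoring (complete n)) (j : Color) : Set where
  field
    φ           : Fin k → Fin n
    φ-injective : Injective _≡_ _≡_ φ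

  φ-edge : ∀ {u v} → Adj H u v → Adj (complete n) (φ u) (φ v)
  φ-edge e φu≡φv = adj-irrefl H (φ-injective φu≡φv) e

  field
    φ-color : ∀ {u v} (e : Adj H u v) → color c (φ u) (φ v) (φ-edge e) ≡ j

open Embedding public

Increasing : ∀ {k n} {H : Graph k} {c : EdgeColoring (complete n)} {j} → Embedding H c j → Set
Increasing f = φ f Preserves _<_ ⟶ _<_

IncreasingEmbedding : ∀ {k n} → Graph k → EdgeColoring (complete n) → Color → Set
IncreasingEmbedding H c j = ∃ λ (f : Embedding H c j) → Increasing f

OrderedRamsey : ∀ {a b} → Graph a → Graph b → ℕ → Set
OrderedRamsey H₁ H₂ n =
  (c : EdgeColoring (complete n)) →
  IncreasingEmbedding H₁ c color₁ ⊎ IncreasingEmbedding H₂ c color₂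

-- "R_ord(H₁, H₂) = n": n is the smallest number with the Ramsey property.
R-ord[_,_]≡_ : ∀ {a b} → Graph a → Graph b → ℕ → Set
R-ord[ H₁ , H₂ ]≡ n = OrderedRamsey H₁ H₂ n × (∀ m → OrderedRamsey H₁ H₂ m → n ≤ m)

{-# OPTIONS --safe #-}
-- Upper bound, by induction on b: among a sorted list of vertices, those without
-- an earlier color-2 neighbour in the list form a color-1 clique.  If there are
-- fewer than a of them, the remaining vertices carry a color-2 path on b − 1
-- vertices by induction, and its first vertex has an earlier color-2 neighbour
-- which extends the path.
-- Lower bound: cut (a − 1)(b − 1) vertices into b − 1 intervals of size a − 1 and
-- give color 1 to the edges inside an interval.  A connected graph in color 1
-- stays inside one interval, and a monotone path in color 2 visits each interval
-- at most once.
module Submission where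

open import Data.Nat.Base using (ℕ; _+_; _*_; _∸_; _≤_)
open import Defs

open import Data.Fin.Base as Fin using (Fin; toℕ; fromℕ; fromℕ<; inject₁)
open import Data.Fin.Induction using (<-weakInduction)
import Data.Fin.Properties as Fin
open import Data.List.Base using (List; []; _∷_; length; lookup; filter; take; allFin)
open import Data.List.Membership.Propositional using (_∈_; find; lose)
open import Data.List.Membership.Propositional.Properties using (∈-filter⁻; ∈-lookup)
open import Data.List.Properties using (length-take; length-tabulate)
import Data.List.Relation.Unary.All as All
open import Data.List.Relation.Unary.AllPairs as AllPairs using (AllPairs; []; _∷_)
import Data.List.Relation.Unary.AllPairs.Properties as AllPairs
open import Data.List.Relation.Unary.Any using (any?; here; there)
open import Data.List.Relation.Unary.Linked as Linked using (Linked; [-]; _∷_)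
open import Data.List.Relation.Unary.Linked.Properties using (Linked⇒AllPairs)
open import Data.Nat.Base using (zero; suc; _<_; z≤n; s≤s⁻¹; s<s⁻¹; NonZero)
open import Data.Nat.DivMod using (_/_; _%_; m≡m%n+[m/n]*n; m%n<n; /-monoˡ-≤; m<n*o⇒m/o<n)
import Data.Nat.Properties as ℕ
open import Data.Product.Base using (∃; ∃₂; Σ-syntax; _×_; _,_; proj₁; proj₂)
open import Data.Sum.Base using (_⊎_; inj₁; inj₂)
open import Function.Base using (_∘_; id)
open import Level using (0ℓ)
open import Relation.Binary.Construct.Closure.ReflexiveTransitive using (Star; fold)
open import Relation.Binary.Core using (Rel; _Preserves_⟶_)
open import Relation.Binary.Definitions using (Decidable; DecidableEquality; tri<; tri≈; tri>)
open import Relation.Binary.PropositionalEquality using (_≡_; _≢_; refl; sym; trans; cong; cong₂; subst; module ≡-Reasoning)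
open import Relation.Nullary.Decidable using (Dec; yes; no; ¬?)
open import Relation.Nullary.Negation using (¬_; contradiction)
import Relation.Unary as Unary

private
  variable
    A : Set
    k n : ℕ

-- Lists: counting, pairwise relations and lookup.

length-filter-¬? : {P : Unary.Pred A 0ℓ} (P? : Unary.Decidable P) (xs : List A) →
  length (filter P? xs) + length (filter (¬? ∘ P?) xs) ≡ length xs
length-filter-¬? P? [] = refl
length-filter-¬? P? (x ∷ xs) with P? x
... | yes _ = cong suc (length-filter-¬? P? xs)
... | no  _ = trans (ℕ.+-suc _ _) (cong suc (length-filter-¬? P? xs))

AllPairs-tabulate : {R : Rel A 0ℓ} {xs : List A} →
  (∀ {x y} → x ∈ xs → y ∈ xs → R x y) → AllPairs R xs
AllPairs-tabulate {xs = []}     f = []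
AllPairs-tabulate {xs = x ∷ xs} f =
  All.tabulate (f (here refl) ∘ there) ∷ AllPairs-tabulate (λ p q → f (there p) (there q))

AllPairs-lookup : {R : Rel A 0ℓ} {xs : List A} → AllPairs R xs →
  ∀ {i j} → i Fin.< j → R (lookup xs i) (lookup xs j)
AllPairs-lookup (Rx ∷ _)  {Fin.zero}  {Fin.suc j} _   = All.lookup Rx (∈-lookup j)
AllPairs-lookup (_ ∷ Rxs) {Fin.suc i} {Fin.suc j} i<j = AllPairs-lookup Rxs (s<s⁻¹ i<j)

Linked-lookup : {R : Rel A 0ℓ} {xs : List A} → Linked R xs →
  ∀ {i j} → suc (toℕ i) ≡ toℕ j → R (lookup xs i) (lookup xs j)
Linked-lookup (Rxy ∷ _) {Fin.zero}  {Fin.suc Fin.zero} _   = Rxy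
Linked-lookup (_ ∷ Rxs) {Fin.suc i} {Fin.suc j}        eq  = Linked-lookup Rxs (ℕ.suc-injective eq)

-- `T` will be the vertex order and `R` a forward edge of color 2. The conjunct `y ∈ xs` strengthens
-- the induction: it places the head of the path among `others`, so that the path can be extended.
clique-or-path : {T R : Rel A 0ℓ} → Decidable R → ∀ a b xs → AllPairs T xs → a * b < length xs →
  (∃ λ ys → length ys ≡ suc a × AllPairs (λ x y → T x y × ¬ R x y) ys) ⊎
  (∃₂ λ y ys → y ∈ xs × length ys ≡ b × Linked R (y ∷ ys))
clique-or-path R? a zero    (x ∷ xs) Txs ab<∣xs∣ = inj₂ (x , [] , here refl , refl , [-])
clique-or-path R? a zero    []       Txs ab<∣xs∣ = contradiction ab<∣xs∣ ℕ.n≮0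
clique-or-path {A} {T} {R} R? a (suc b) xs Txs ab<∣xs∣ = go (suc a ℕ.≤? length sources)
  where
  hasPred? : Unary.Decidable (λ y → Unary.Satisfiable (λ x → x ∈ xs × R x y))
  hasPred? y with any? (λ x → R? x y) xs
  ... | yes p = yes (find p)
  ... | no ¬p = no λ (_ , x∈xs , Rxy) → ¬p (lose x∈xs Rxy)

  sources others : List A
  sources = filter (¬? ∘ hasPred?) xs
  others  = filter hasPred? xs

  sources-clique : AllPairs (λ x y → T x y × ¬ R x y) sources
  sources-clique = AllPairs.zip
    ( AllPairs.filter⁺ (¬? ∘ hasPred?) Txs
    -- A source lies in `xs`, so `R x y` would make it a predecessor of the source `y`.
    , AllPairs-tabulate λ x∈ y∈ Rxy →
        proj₂ (∈-filter⁻ (¬? ∘ hasPred?) {xs = xs} y∈)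
          (_ , proj₁ (∈-filter⁻ (¬? ∘ hasPred?) x∈) , Rxy)
    )

  many-others : length sources ≤ a → a * b < length others
  many-others ∣sources∣≤a = ℕ.≰⇒> λ ∣others∣≤ab → ℕ.<⇒≱ ab<∣xs∣ (begin
    length xs                      ≡⟨ length-filter-¬? hasPred? xs ⟨
    length others + length sources ≤⟨ ℕ.+-mono-≤ ∣others∣≤ab ∣sources∣≤a ⟩
    a * b + a                      ≡⟨ ℕ.+-comm (a * b) a ⟩
    a + a * b                      ≡⟨ ℕ.*-suc a b ⟨
    a * suc b                      ∎)
    where open ℕ.≤-Reasoning

  go : Dec (suc a ≤ length sources) → _
  go (yes a<∣sources∣) = inj₁
    ( take (suc a) sources
    , trans (length-take (suc a) sources) (ℕ.m≤n⇒m⊓n≡m a<∣sources∣)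
    , AllPairs.take⁺ (suc a) sources-clique
    )
  go (no a≮∣sources∣)
    with clique-or-path R? a b others (AllPairs.filter⁺ hasPred? Txs)
           (many-others (s≤s⁻¹ (ℕ.≰⇒> a≮∣sources∣)))
  ... | inj₁ clique = inj₁ clique
  ... | inj₂ (y , ys , y∈others , ∣ys∣≡b , path)
    -- The predecessor `x` is taken from all of `xs`, which is the membership that the enclosing
    -- step must return.
    with x , x∈xs , Rxy ← proj₂ (∈-filter⁻ hasPred? {xs = xs} y∈others) =
    inj₂ (x , y ∷ ys , x∈xs , cong suc ∣ys∣≡b , Rxy ∷ path)

-- From lists of vertices to increasing embeddings.

_≟ᶜ_ : DecidableEquality Color
color₁ ≟ᶜ color₁ = yes refl
color₁ ≟ᶜ color₂ = no λ ()
color₂ ≟ᶜ color₁ = no λ ()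
color₂ ≟ᶜ color₂ = yes refl

≢color₂⇒≡color₁ : ∀ {j} → j ≢ color₂ → j ≡ color₁
≢color₂⇒≡color₁ {color₁} _  = refl
≢color₂⇒≡color₁ {color₂} ≢₂ = contradiction refl ≢₂

-- With the order bundled in, a linked list is automatically increasing, and `u<v` supplies the edge
-- proof that `color` asks for.
ForwardEdge : EdgeColoring (complete n) → Color → Rel (Fin n) 0ℓ
ForwardEdge c j u v = Σ[ u<v ∈ u Fin.< v ] color c u v (Fin.<⇒≢ u<v) ≡ j

forwardEdge? : (c : EdgeColoring (complete n)) (j : Color) → Decidable (ForwardEdge c j)
forwardEdge? c j u v with u Fin.<? v
... | no  u≮v = no (u≮v ∘ proj₁)
... | yes u<v with color c u v (Fin.<⇒≢ u<v) ≟ᶜ j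
...   | yes eq  = yes (u<v , eq)
...   | no  neq = no (neq ∘ proj₂)

increasing⇒injective : {f : Fin k → Fin n} → f Preserves Fin._<_ ⟶ Fin._<_ →
  ∀ {u v} → f u ≡ f v → u ≡ v
increasing⇒injective mono {u} {v} fu≡fv with Fin.<-cmp u v
... | tri< u<v _ _ = contradiction fu≡fv (Fin.<⇒≢ (mono u<v))
... | tri≈ _ u≡v _ = u≡v
... | tri> _ _ v<u = contradiction (sym fu≡fv) (Fin.<⇒≢ (mono v<u))

increasingEmbedding : (H : Graph k) (c : EdgeColoring (complete n)) (j : Color)
  (f : Fin k → Fin n) → f Preserves Fin._<_ ⟶ Fin._<_ →
  (∀ {u v} → u Fin.< v → Adj H u v → ForwardEdge c j (f u) (f v)) →
  IncreasingEmbedding H c j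
increasingEmbedding H c j f mono edge = record
  { φ           = f
  ; φ-injective = inj
  ; φ-color     = col
  } , mono
  where
  inj : ∀ {u v} → f u ≡ f v → u ≡ v
  inj = increasing⇒injective mono

  col : ∀ {u v} (e : Adj H u v) → color c (f u) (f v) (λ p → adj-irrefl H (inj p) e) ≡ j
  col {u} {v} e with Fin.<-cmp u v
  -- The edge argument of `color` is irrelevant, so the proof inside `ForwardEdge` may stand for the
  -- one built from `inj`.
  ... | tri< u<v _ _ = proj₂ (edge u<v e)
  ... | tri≈ _ u≡v _ = contradiction e (adj-irrefl H u≡v)
  ... | tri> _ _ v<u = trans
    (color-sym c (λ p → adj-irrefl H (inj p) e))
    (proj₂ (edge v<u (adj-sym H e)))

clique⇒embedding : (H : Graph k) (c : EdgeColoring (complete n)) (j : Color) {ys : List (Fin n)} →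
  length ys ≡ k → AllPairs (ForwardEdge c j) ys → IncreasingEmbedding H c j
clique⇒embedding H c j {ys} refl clique =
  increasingEmbedding H c j (lookup ys) (proj₁ ∘ AllPairs-lookup clique)
    (λ u<v _ → AllPairs-lookup clique u<v)

-- Transitivity of `<` orders all entries, while the color is known only for neighbours in the list,
-- which are the edges of the path.
linked⇒embedding : (c : EdgeColoring (complete n)) (j : Color) {ys : List (Fin n)} →
  length ys ≡ k → Linked (ForwardEdge c j) ys → IncreasingEmbedding (monotonePath k) c j
linked⇒embedding c j {ys} refl path =
  increasingEmbedding (monotonePath _) c j (lookup ys)
    (AllPairs-lookup (Linked⇒AllPairs Fin.<-trans (Linked.map proj₁ path)))
    λ { u<v (inj₁ consecutive) → Linked-lookup path consecutive
      ; u<v (inj₂ 1+v≡u) → contradiction (ℕ.≤-reflexive 1+v≡u) (ℕ.<-asym u<v) }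

upperBound : ∀ {a b} (H : Graph (suc a)) → OrderedRamsey H (monotonePath (suc b)) (suc (a * b))
upperBound {a} {b} H c
  with clique-or-path (forwardEdge? c color₂) a b (allFin _) (AllPairs.tabulate⁺-< id)
         (ℕ.≤-reflexive (sym (length-tabulate id)))
... | inj₁ (ys , ∣ys∣≡1+a , clique) = inj₁ (clique⇒embedding H c color₁ ∣ys∣≡1+a
  -- Given `u<v`, the pair can fail to be a forward edge of color 2 only through its color.
  (AllPairs.map (λ (u<v , not₂) → u<v , ≢color₂⇒≡color₁ (not₂ ∘ (u<v ,_))) clique))
... | inj₂ (y , ys , _ , ∣ys∣≡b , path) =
  inj₂ (linked⇒embedding c color₂ (cong suc ∣ys∣≡b) path)

-- The interval coloring and the lower bound.

sameBlockColor : ℕ → ℕ → Color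
sameBlockColor p q with p ℕ.≟ q
... | yes _ = color₁
... | no  _ = color₂

sameBlockColor-comm : ∀ p q → sameBlockColor p q ≡ sameBlockColor q p
sameBlockColor-comm p q with p ℕ.≟ q | q ℕ.≟ p
... | yes _   | yes _   = refl
... | no  _   | no  _   = refl
... | yes p≡q | no  q≢p = contradiction (sym p≡q) q≢p
... | no  p≢q | yes q≡p = contradiction (sym q≡p) p≢q

sameBlockColor₁⇒≡ : ∀ p q → sameBlockColor p q ≡ color₁ → p ≡ q
sameBlockColor₁⇒≡ p q eq with p ℕ.≟ q
... | yes p≡q = p≡q
sameBlockColor₁⇒≡ p q () | no _

sameBlockColor₂⇒≢ : ∀ p q → sameBlockColor p q ≡ color₂ → p ≢ q
sameBlockColor₂⇒≢ p q eq with p ℕ.≟ q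
... | no p≢q = p≢q
sameBlockColor₂⇒≢ p q () | yes _

consecutive-<⇒toℕ≤ : (f : Fin (suc k) → ℕ) →
  (∀ i → f (inject₁ i) < f (Fin.suc i)) → ∀ i → toℕ i ≤ f i
consecutive-<⇒toℕ≤ f f< = <-weakInduction (λ i → toℕ i ≤ f i) z≤n λ i i≤fi →
  ℕ.≤-<-trans (subst (_≤ f (inject₁ i)) (Fin.toℕ-inject₁ i) i≤fi) (f< i)

-- `d` is the interval length. `n` stays free, as minimality asks for a bad coloring at every order
-- up to `d * b`.
module BlockColoring (d n : ℕ) .{{_ : NonZero d}} where

  block : Fin n → ℕ
  block u = toℕ u / d

  coloring : EdgeColoring (complete n)
  coloring = record
    { color     = λ u v _ → sameBlockColor (block u) (block v)
    ; color-sym = λ {u} {v} _ → sameBlockColor-comm (block u) (block v)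
    }

  -- Among `suc d` images two agree modulo `d`. Connectedness gives them the same quotient as well,
  -- so they coincide, against injectivity.
  no-connected-color₁ : (H : Graph (suc d)) → Connected H → ¬ Embedding H coloring color₁
  no-connected-color₁ H conn f =
    let i , j , i<j , eq = Fin.pigeonhole (ℕ.n<1+n d) (λ u → fromℕ< (m%n<n (toℕ (φ f u)) d))
    in Fin.<⇒≢ i<j (φ-injective f (Fin.toℕ-injective (toℕ-≡
         (Fin.fromℕ<-injective _ _ (m%n<n _ d) (m%n<n _ d) eq)
         (sameBlock (conn i j)))))
    where
    sameBlock : ∀ {u v} → Star (Adj H) u v → block (φ f u) ≡ block (φ f v)
    sameBlock = fold (λ u v → block (φ f u) ≡ block (φ f v))
      (λ e → trans (sameBlockColor₁⇒≡ _ _ (φ-color f e))) refl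

    toℕ-≡ : ∀ {p q} → p % d ≡ q % d → p / d ≡ q / d → p ≡ q
    toℕ-≡ {p} {q} %≡ /≡ = begin
      p                   ≡⟨ m≡m%n+[m/n]*n p d ⟩
      p % d + (p / d) * d ≡⟨ cong₂ (λ r s → r + s * d) %≡ /≡ ⟩
      q % d + (q / d) * d ≡⟨ m≡m%n+[m/n]*n q d ⟨
      q                   ∎
      where open ≡-Reasoning

  -- Block numbers rise strictly along the `suc b` vertices, so the last one is at least `b`, but
  -- every block number is below `b`.
  no-path-color₂ : ∀ {b} → n ≤ d * b →
    ¬ IncreasingEmbedding (monotonePath (suc b)) coloring color₂
  no-path-color₂ {b} n≤db (f , mono) = ℕ.<⇒≱
    (m<n*o⇒m/o<n (ℕ.<-≤-trans (Fin.toℕ<n (φ f (fromℕ b)))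
      (ℕ.≤-trans n≤db (ℕ.≤-reflexive (ℕ.*-comm d b)))))
    (subst (_≤ block (φ f (fromℕ b))) (Fin.toℕ-fromℕ b)
      (consecutive-<⇒toℕ≤ (block ∘ φ f) block-< (fromℕ b)))
    where
    block-< : ∀ i → block (φ f (inject₁ i)) < block (φ f (Fin.suc i))
    -- The order of the images gives `≤` after division; color 2 excludes equality.
    block-< i = ℕ.≤∧≢⇒<
      (/-monoˡ-≤ d (ℕ.<⇒≤ (mono (ℕ.≤-reflexive i+1≡))))
      (sameBlockColor₂⇒≢ _ _ (φ-color f (inj₁ i+1≡)))
      where
      i+1≡ : suc (toℕ (inject₁ i)) ≡ toℕ (Fin.suc i)
      i+1≡ = cong suc (Fin.toℕ-inject₁ i)

lowerBound : ∀ {a b} (H : Graph (suc a)) → Connected H → ∀ m → m ≤ a * b →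
  ¬ OrderedRamsey H (monotonePath (suc b)) m
lowerBound {zero} H conn .0 z≤n ramsey
  -- Intervals of length 0 do not exist, but here `m` is 0, and vertex 0 of either graph has no
  -- image in the empty graph.
  with ramsey (record { color = λ () ; color-sym = λ { {()} } })
... | inj₁ (f , _) = Fin.¬Fin0 (φ f Fin.zero)
... | inj₂ (f , _) = Fin.¬Fin0 (φ f Fin.zero)
lowerBound {a@(suc _)} H conn m m≤ab ramsey with ramsey (BlockColoring.coloring a m)
... | inj₁ (f , _) = BlockColoring.no-connected-color₁ a m H conn f
... | inj₂ f       = BlockColoring.no-path-color₂ a m m≤ab f

theorem4p1 : ∀ (a : ℕ) → 1 ≤ a → (H : Graph a) → Connected H →
    ∀ (b : ℕ) → 1 ≤ b → R-ord[ H , monotonePath b ]≡ (1 + (a ∸ 1) * (b ∸ 1))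
theorem4p1 (suc a) _ H conn (suc b) _ =
  -- `a` and `b` now denote the predecessors, so the bound computes to `suc (a * b)`.
  upperBound H , λ m ramsey → ℕ.≰⇒> λ m≤ab → lowerBound H conn m m≤ab ramsey
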